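{- Let $m\ge1$. If $m$ is odd, then every compact magic hypercube of order $4$ and dimension $m$ is automatically pandiagonal. If $m$ is even, then every compact and pandiagonal magic hypercube of order $4$ and dimension $m$ is automatically most-perfect.
   Context: A magic hypercube of order $4$ and dimension $m$ is an arrangement of the numbers $1,2,\ldots,4^m$ (each used once) in a $4\times\cdots\times4$ ($m$-fold) grid, with positions indexed by $(\mathbb Z/4\mathbb Z)^m$, such that every orthogonal line (four positions obtained by fixing all but one coordinate) has the same magic sum. It is compact if every $2\times2$ subsquare (positions obtained by fixing all but two coordinates and letting those two range over $\{i,i+1\}\times\{k,k+1\}$ modulo $4$, wrap-around included) also has that magic sum. A great pandiagonal is a toroidal line $\{p+t\,d: t\in\mathbb Z/4\mathbb Z\}$ with $p\in(\mathbb Z/4\mathbb Z)^m$, $d\in\{\pm1\}^m$ (this includes great diagonals). The hypercube is pandiagonal if every great pandiagonal has the magic sum; it is complete if every pair of entries two apart on a great pandiagonal adds up to half the magic sum; it is most-perfect if it is magic, compact, pandiagonal and complete. -}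

module Defs where

open import Data.Fin using (Fin; toℕ)
open import Data.Fin.Patterns using (1F; 2F)
open import Data.Nat using (ℕ; suc; _+_; _*_; _∸_; _^_)
open import Data.Nat.DivMod using (_mod_)
open import Data.Sign using (Sign)
open import Data.Vec using (Vec; zipWith; sum; tabulate; _[_]≔_)
open import Function using (_⤖_; Bijection)
open import Relation.Binary.PropositionalEquality using (_≡_; _≢_)

infixl 6 _⊕_
infixr 7 _·_

-- ℤ/4ℤ, represented by the residues 0, 1, 2, 3.
ℤ₄ : Set
ℤ₄ = Fin 4

_⊕_ : ℤ₄ → ℤ₄ → ℤ₄
a ⊕ b = (toℕ a + toℕ b) mod 4

⊖_ : ℤ₄ → ℤ₄
⊖ a = (4 ∸ toℕ a) mod 4

_·_ : Sign → ℤ₄ → ℤ₄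
Sign.+ · t = t
Sign.- · t = ⊖ t

Position : ℕ → Set
Position m = Vec ℤ₄ m

-- The cell p holds the number 1 + toℕ (to p), so the numbers 1, …, 4 ^ m are
-- each used exactly once; see entry.
Hypercube : ℕ → Set
Hypercube m = Position m ⤖ Fin (4 ^ m)

entry : ∀ {m} → Hypercube m → Position m → ℕ
entry h p = suc (toℕ (Bijection.to h p))

-- The point p + t d of the toroidal line through p with direction d ∈ {±1}ᵐ.
along : ∀ {m} → Position m → Vec Sign m → ℤ₄ → Position m
along p d t = zipWith (λ x s → x ⊕ s · t) p d

-- In the following, S is the magic sum.

-- The orthogonal line through p in direction i consists of the p [ i ]≔ a.
Magic : ∀ {m} → ℕ → Hypercube m → Set
Magic {m} S h = (p : Position m) (i : Fin m) →
  sum (tabulate (λ a → entry h (p [ i ]≔ a))) ≡ S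

-- The coordinates of p other than i and k are the fixed ones.
Compact : ∀ {m} → ℕ → Hypercube m → Set
Compact {m} S h = (p : Position m) (i k : Fin m) → i ≢ k → (a b : ℤ₄) →
  let cell : ℤ₄ → ℤ₄ → ℕ
      cell x y = entry h (p [ i ]≔ x [ k ]≔ y)
  in cell a b + cell a (b ⊕ 1F) + cell (a ⊕ 1F) b + cell (a ⊕ 1F) (b ⊕ 1F) ≡ S

Pandiagonal : ∀ {m} → ℕ → Hypercube m → Set
Pandiagonal {m} S h = (p : Position m) (d : Vec Sign m) →
  sum (tabulate (λ t → entry h (along p d t))) ≡ S

-- The two entries add up to S / 2; doubling avoids truncated division.
Complete : ∀ {m} → ℕ → Hypercube m → Set
Complete {m} S h = (p : Position m) (d : Vec Sign m) (t : ℤ₄) →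
  2 * (entry h (along p d t) + entry h (along p d (t ⊕ 2F))) ≡ S

record MostPerfect {m : ℕ} (S : ℕ) (h : Hypercube m) : Set where
  field
    magic       : Magic S h
    compact     : Compact S h
    pandiagonal : Pandiagonal S h
    complete    : Complete S h

{-# OPTIONS --safe #-}

-- Write m = 1 + n, and let A t s be the entry whose first coordinate has moved
-- t steps along the diagonal and whose other n coordinates have moved s steps.
-- By compactness the sums A t s + A (t + 1) s and A t (s + 1) + A (t + 1) (s + 1)
-- are equal if n is even and add up to S if n is odd. Together with the magic
-- lines s = const this gives, by induction on m, for the entries a₀, …, a₃ of a
-- great pandiagonal
--   m odd:  a₀ + a₁ + a₂ + a₃ = S,    m even:  a₀ + a₂ = a₁ + a₃.
-- For even m, pandiagonality then forces 2 (a₀ + a₂) = 2 (a₁ + a₃) = S.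
module Submission where

open import Defs
open import Data.Empty using (⊥-elim)
open import Data.Fin using (Fin; zero; suc)
open import Data.Fin.Patterns using (0F; 1F; 2F; 3F)
open import Data.Fin.Properties using (suc-injective)
open import Data.Nat using (ℕ; zero; suc; _+_; _*_; _≤_)
open import Data.Nat.Divisibility
  using (_∣_; _∤_; _∣0; ∣-refl; ∣m∣n⇒∣m+n; ∣m+n∣m⇒∣n; ∣1⇒≡1)
open import Data.Nat.Properties using (+-comm; +-cancelʳ-≡)
open import Data.Nat.Tactic.RingSolver using (solve-∀)
open import Data.Product using (_×_; _,_)
open import Data.Sign using (Sign)
open import Data.Vec using (Vec; []; _∷_; sum; tabulate; _[_]≔_)
open import Function using (_∘_)
open import Relation.Binary.Definitions using (Symmetric)
open import Relation.Binary.PropositionalEquality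
  using (_≡_; _≢_; refl; sym; trans; cong; cong₂; subst)

-- Parity of the dimension

2∣suc⇒2∤ : ∀ {n} → 2 ∣ suc n → 2 ∤ n
2∣suc⇒2∤ {n} 2∣1+n 2∣n
  with () ← ∣1⇒≡1 (∣m+n∣m⇒∣n (subst (2 ∣_) (+-comm 1 n) 2∣1+n) 2∣n)

2∤suc⇒2∣ : ∀ n → 2 ∤ suc n → 2 ∣ n
2∤suc⇒2∣ zero          _     = 2 ∣0
2∤suc⇒2∣ (suc zero)    2∤2   = ⊥-elim (2∤2 ∣-refl)
2∤suc⇒2∣ (suc (suc n)) 2∤3+n =
  ∣m∣n⇒∣m+n ∣-refl (2∤suc⇒2∣ n (2∤3+n ∘ ∣m∣n⇒∣m+n ∣-refl))

-- Derives l ≡ r from a consequence L ≡ R of the hypotheses such that the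
-- identity l − r = L − R holds in every commutative ring.
by-linear-combination : ∀ {l r L R : ℕ} → L ≡ R → l + R ≡ r + L → l ≡ r
by-linear-combination {l} {r} {L} refl e = +-cancelʳ-≡ L l r e

infixl 6 _⊞_
_⊞_ : ∀ {a b c d : ℕ} → a ≡ b → c ≡ d → a + c ≡ b + d
_⊞_ = cong₂ _+_

-- Lines in a single coordinate

-- A negative sign makes the coordinate go down by one at each step. Since `P` is symmetric, that is
-- an upward step read backwards.
neighbours : ∀ {ℓ} {P : ℤ₄ → ℤ₄ → Set ℓ} → Symmetric P → (∀ a → P a (a ⊕ 1F)) →
  ∀ x s t → P (x ⊕ s · t) (x ⊕ s · (t ⊕ 1F))
neighbours {P = P} P-sym step = go
  where
  up : ∀ x t → (x ⊕ t) ⊕ 1F ≡ x ⊕ (t ⊕ 1F)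
  up 0F 0F = refl
  up 0F 1F = refl
  up 0F 2F = refl
  up 0F 3F = refl
  up 1F 0F = refl
  up 1F 1F = refl
  up 1F 2F = refl
  up 1F 3F = refl
  up 2F 0F = refl
  up 2F 1F = refl
  up 2F 2F = refl
  up 2F 3F = refl
  up 3F 0F = refl
  up 3F 1F = refl
  up 3F 2F = refl
  up 3F 3F = refl

  ⊖-⊕1 : ∀ t → ⊖ t ≡ (⊖ (t ⊕ 1F)) ⊕ 1F
  ⊖-⊕1 0F = refl
  ⊖-⊕1 1F = refl
  ⊖-⊕1 2F = refl
  ⊖-⊕1 3F = refl

  go : ∀ x s t → P (x ⊕ s · t) (x ⊕ s · (t ⊕ 1F))
  go x Sign.+ t = subst (P (x ⊕ t)) (up x t) (step (x ⊕ t))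
  go x Sign.- t = P-sym (subst (P y) y⊕1≡ (step y))
    where
    y = x ⊕ ⊖ (t ⊕ 1F)
    y⊕1≡ : y ⊕ 1F ≡ x ⊕ ⊖ t
    y⊕1≡ = trans (up x (⊖ (t ⊕ 1F))) (cong (x ⊕_) (sym (⊖-⊕1 t)))

rotate : ∀ a b c d → b + (c + (d + (a + 0))) ≡ a + (b + (c + (d + 0)))
rotate = solve-∀

reflect : ∀ a b c d → a + (d + (c + (b + 0))) ≡ a + (b + (c + (d + 0)))
reflect = solve-∀

-- The residues `x ⊕ s · t` run once through ℤ/4ℤ: cyclically shifted for `Sign.+`, and with the
-- last three of these reversed for `Sign.-`.
sum-line : ∀ (g : ℤ₄ → ℕ) x s →
  sum (tabulate (λ t → g (x ⊕ s · t))) ≡ sum (tabulate g)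
sum-line g = go
  where
  ascending : ∀ x → sum (tabulate (λ t → g (x ⊕ t))) ≡ sum (tabulate g)
  ascending 0F = refl
  ascending 1F = rotate (g 0F) (g 1F) (g 2F) (g 3F)
  ascending 2F = trans (rotate (g 1F) (g 2F) (g 3F) (g 0F)) (rotate (g 0F) (g 1F) (g 2F) (g 3F))
  ascending 3F = sym (rotate (g 3F) (g 0F) (g 1F) (g 2F))

  go : ∀ x s → sum (tabulate (λ t → g (x ⊕ s · t))) ≡ sum (tabulate g)
  go x  Sign.+ = ascending x
  go 0F Sign.- = reflect (g 0F) (g 1F) (g 2F) (g 3F)
  go 1F Sign.- = trans (reflect (g 1F) (g 2F) (g 3F) (g 0F)) (ascending 1F)
  go 2F Sign.- = trans (reflect (g 2F) (g 3F) (g 0F) (g 1F)) (ascending 2F)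
  go 3F Sign.- = trans (reflect (g 3F) (g 0F) (g 1F) (g 2F)) (ascending 3F)

-- For f = entry h, MagicFun S f and CompactFun S f are Magic S h and
-- Compact S h. The induction on the dimension restricts f to hyperplanes, where
-- it is no longer a hypercube.
MagicFun : ∀ {m} → ℕ → (Position m → ℕ) → Set
MagicFun {m} S f = (p : Position m) (i : Fin m) →
  sum (tabulate (λ a → f (p [ i ]≔ a))) ≡ S

CompactFun : ∀ {m} → ℕ → (Position m → ℕ) → Set
CompactFun {m} S f = (p : Position m) (i k : Fin m) → i ≢ k → (a b : ℤ₄) →
  let cell : ℤ₄ → ℤ₄ → ℕ
      cell x y = f (p [ i ]≔ x [ k ]≔ y)
  in cell a b + cell a (b ⊕ 1F) + cell (a ⊕ 1F) b + cell (a ⊕ 1F) (b ⊕ 1F) ≡ S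

-- Alternating functions and their diagonals

-- This is what compactness leaves when two adjacent parallel hyperplanes are added cell by cell.
Alternating : ∀ {m} → ℕ → (Position m → ℕ) → Set
Alternating {m} S f = (p : Position m) (i : Fin m) (a : ℤ₄) →
  f (p [ i ]≔ a) + f (p [ i ]≔ (a ⊕ 1F)) ≡ S

pairSum : ∀ {n} → (Position (suc n) → ℕ) → ℤ₄ → Sign → ℤ₄ → Position n → ℕ
pairSum f x s t q = f (x ⊕ s · t ∷ q) + f (x ⊕ s · (t ⊕ 1F) ∷ q)

slice : ∀ {n} → (Position (suc n) → ℕ) → ℤ₄ → Position n → ℕ
slice f x q = f (x ∷ q)

alternating-slice : ∀ {n S} (f : Position (suc n) → ℕ) →
  Alternating S f → ∀ x → Alternating S (slice f x)
alternating-slice f alt x q i = alt (x ∷ q) (suc i)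

magic-slice : ∀ {n S} (f : Position (suc n) → ℕ) →
  MagicFun S f → ∀ x → MagicFun S (slice f x)
magic-slice f magic x q i = magic (x ∷ q) (suc i)

compact-slice : ∀ {n S} (f : Position (suc n) → ℕ) →
  CompactFun S f → ∀ x → CompactFun S (slice f x)
compact-slice f compact x q i k i≢k =
  compact (x ∷ q) (suc i) (suc k) (i≢k ∘ suc-injective)

alternating-pairSum : ∀ {n S} (f : Position (suc n) → ℕ) → Alternating S f →
  ∀ x s t q → pairSum f x s t q ≡ S
alternating-pairSum {S = S} f alt x s t q =
  neighbours {P = λ a b → f (a ∷ q) + f (b ∷ q) ≡ S}
    (λ {a} {b} e → trans (+-comm (f (b ∷ q)) (f (a ∷ q))) e)
    -- The `0F` is a placeholder that the update at `zero` overwrites.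
    (alt (0F ∷ q) zero) x s t

mutual
  -- Moving one coordinate by ±1 turns a value v into S - v. A diagonal step moves all `n`
  -- coordinates, so it restores v for even `n` and gives S - v for odd `n`.
  alternating-even : ∀ {n S} (f : Position n → ℕ) → 2 ∣ n → Alternating S f →
    ∀ p d t → f (along p d t) ≡ f (along p d (t ⊕ 1F))
  alternating-even f _ _ [] [] t = refl
  alternating-even f 2∣n alt (x ∷ p) (s ∷ d) t =
    -- Both sides complete `f (y ∷ q)` to `S`.
    +-cancelʳ-≡ (f (y ∷ q)) _ _
      (trans (alternating-pairSum f alt x s t q)
        (trans
          (sym (alternating-odd (slice f y) (2∣suc⇒2∤ 2∣n) (alternating-slice f alt y) p d t))
          (+-comm (f (y ∷ q)) _)))
    where
    y = x ⊕ s · (t ⊕ 1F)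
    q = along p d t

  alternating-odd : ∀ {n S} (f : Position n → ℕ) → 2 ∤ n → Alternating S f →
    ∀ p d t → f (along p d t) + f (along p d (t ⊕ 1F)) ≡ S
  alternating-odd f 2∤0 _ [] [] t = ⊥-elim (2∤0 (2 ∣0))
  alternating-odd {suc n} f 2∤n alt (x ∷ p) (s ∷ d) t =
    trans
      (cong (f (x ⊕ s · t ∷ along p d t) +_)
        (sym (alternating-even (slice f y) (2∤suc⇒2∣ n 2∤n) (alternating-slice f alt y) p d t)))
      (alternating-pairSum f alt x s t (along p d t))
    where
    y = x ⊕ s · (t ⊕ 1F)

-- Two neighbouring cells of the added hyperplanes together hold a 2 × 2 subsquare in the
-- coordinates `zero` and `suc i`.
pairSum-alternating : ∀ {n S} (f : Position (suc n) → ℕ) → CompactFun S f →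
  ∀ x s t → Alternating S (pairSum f x s t)
pairSum-alternating {S = S} f compact =
  neighbours {P = λ a b → Alternating S (λ q → f (a ∷ q) + f (b ∷ q))}
    (λ {a} {b} alt p i c →
      trans (+-comm (f (b ∷ (p [ i ]≔ c))) _ ⊞ +-comm (f (b ∷ (p [ i ]≔ (c ⊕ 1F)))) _)
        (alt p i c))
    (λ a p i c → trans (interchange (f (a ∷ (p [ i ]≔ c))) _ _ _)
      (compact (0F ∷ p) zero (suc i) (λ ()) a c))
  where
  interchange : ∀ u v w z → (u + v) + (w + z) ≡ u + w + v + z
  interchange = solve-∀

-- Diagonals of a 4 × 4 grid

Grid : Set
Grid = ℤ₄ → ℤ₄ → ℕ

pair : Grid → ℤ₄ → ℤ₄ → ℕ
pair A t s = A t s + A (t ⊕ 1F) s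

-- Constant pair sums give A t s = A t 1 + (-1)^t (A 0 s - A 0 1). Hence the diagonal exceeds the
-- line s = 1 by the alternating sum of the row t = 0, which vanishes.
diagonal-odd : ∀ {S} (A : Grid) →
  (∀ t s → pair A t s ≡ pair A t (s ⊕ 1F)) →
  (∀ s → sum (tabulate (λ t → A t s)) ≡ S) →
  A 0F 0F + A 0F 2F ≡ A 0F 1F + A 0F 3F →
  sum (tabulate (λ t → A t t)) ≡ S
diagonal-odd {S} A pair-const line row =
  by-linear-combination
    (row ⊞ pair-const 1F 2F ⊞ sym (pair-const 0F 2F) ⊞ line 1F
      ⊞ sym (pair-const 2F 1F) ⊞ sym (pair-const 2F 2F))
    (identity (A 0F 0F) (A 0F 1F) (A 0F 2F) (A 0F 3F)
              (A 1F 1F) (A 1F 2F) (A 1F 3F)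
              (A 2F 1F) (A 2F 2F) (A 2F 3F)
              (A 3F 1F) (A 3F 2F) (A 3F 3F) S)
  where
  identity : ∀ a₀ a₁ a₂ a₃ b₁ b₂ b₃ c₁ c₂ c₃ d₁ d₂ d₃ S →
    (a₀ + (b₁ + (c₂ + (d₃ + 0))))
      + ((a₁ + a₃) + (b₃ + c₃) + (a₂ + b₂) + S + (c₁ + d₁) + (c₂ + d₂))
    ≡ S + ((a₀ + a₂) + (b₂ + c₂) + (a₃ + b₃) + (a₁ + (b₁ + (c₁ + (d₁ + 0))))
      + (c₂ + d₂) + (c₃ + d₃))
  identity = solve-∀

-- The pair sums yield A 2 2 + A 2 3 = A 0 2 + A 0 3 and A 3 3 + A 2 3 = A 2 1 + A 3 1. So the left
-- side minus the right is the row t = 0 minus the line s = 1, that is, S - S.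
diagonal-even : ∀ {S} (A : Grid) →
  (∀ t s → pair A t s + pair A t (s ⊕ 1F) ≡ S) →
  (∀ s → sum (tabulate (λ t → A t s)) ≡ S) →
  sum (tabulate (A 0F)) ≡ S →
  A 0F 0F + A 2F 2F ≡ A 1F 1F + A 3F 3F
diagonal-even {S} A pair-alt line row =
  by-linear-combination
    (row ⊞ pair-alt 1F 2F ⊞ sym (pair-alt 0F 2F) ⊞ sym (line 1F)
      ⊞ pair-alt 2F 1F ⊞ sym (pair-alt 2F 2F))
    (identity (A 0F 0F) (A 0F 1F) (A 0F 2F) (A 0F 3F)
              (A 1F 1F) (A 1F 2F) (A 1F 3F)
              (A 2F 1F) (A 2F 2F) (A 2F 3F)
              (A 3F 1F) (A 3F 2F) (A 3F 3F) S)
  where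
  identity : ∀ a₀ a₁ a₂ a₃ b₁ b₂ b₃ c₁ c₂ c₃ d₁ d₂ d₃ S →
    (a₀ + c₂)
      + (S + S + ((a₂ + b₂) + (a₃ + b₃)) + (a₁ + (b₁ + (c₁ + (d₁ + 0))))
        + S + ((c₂ + d₂) + (c₃ + d₃)))
    ≡ (b₁ + d₃)
      + ((a₀ + (a₁ + (a₂ + (a₃ + 0)))) + ((b₂ + c₂) + (b₃ + c₃)) + S + S
        + ((c₁ + d₁) + (c₂ + d₂)) + S)
  identity = solve-∀

-- Fixing `t` leaves a great pandiagonal of a hyperplane, fixing `s` an orthogonal line.
grid : ∀ {n} → (Position (suc n) → ℕ) → Position (suc n) → Vec Sign (suc n) → Grid
grid f (x ∷ p) (s₀ ∷ d) t s = f (x ⊕ s₀ · t ∷ along p d s)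

grid-line : ∀ {n S} (f : Position (suc n) → ℕ) → MagicFun S f →
  ∀ p d s → sum (tabulate (λ t → grid f p d t s)) ≡ S
grid-line f magic (x ∷ p) (s₀ ∷ d) s =
  trans (sum-line (λ a → f (a ∷ along p d s)) x s₀) (magic (0F ∷ along p d s) zero)

-- Induction on the dimension

mutual
  pandiagonal-odd : ∀ {m S} (f : Position m → ℕ) → 2 ∤ m →
    MagicFun S f → CompactFun S f →
    ∀ p d → sum (tabulate (λ t → f (along p d t))) ≡ S
  pandiagonal-odd f 2∤0 _ _ [] [] = ⊥-elim (2∤0 (2 ∣0))
  pandiagonal-odd {suc n} f 2∤m magic compact (x ∷ p) (s ∷ d) =
    diagonal-odd (grid f (x ∷ p) (s ∷ d))
      (λ t → alternating-even (pairSum f x s t) 2∣n (pairSum-alternating f compact x s t) p d)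
      (grid-line f magic (x ∷ p) (s ∷ d))
      (pandiagonal-even (slice f y) 2∣n (magic-slice f magic y) (compact-slice f compact y) p d)
    where
    2∣n = 2∤suc⇒2∣ n 2∤m
    -- Left in this form, the hyperplane of step 0 agrees definitionally with the row `0F` of the
    -- grid.
    y = x ⊕ s · 0F

  pandiagonal-even : ∀ {m S} (f : Position m → ℕ) → 2 ∣ m →
    MagicFun S f → CompactFun S f →
    ∀ p d → f (along p d 0F) + f (along p d 2F) ≡ f (along p d 1F) + f (along p d 3F)
  -- Dimension 0 starts the induction: all four points are the same cell.
  pandiagonal-even f _ _ _ [] [] = refl
  pandiagonal-even f 2∣m magic compact (x ∷ p) (s ∷ d) =
    diagonal-even (grid f (x ∷ p) (s ∷ d))
      (λ t → alternating-odd (pairSum f x s t) 2∤n (pairSum-alternating f compact x s t) p d)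
      (grid-line f magic (x ∷ p) (s ∷ d))
      (pandiagonal-odd (slice f y) 2∤n (magic-slice f magic y) (compact-slice f compact y) p d)
    where
    2∤n = 2∣suc⇒2∤ 2∣m
    y = x ⊕ s · 0F

-- Completeness in even dimension

halves : ∀ {S} (a : ℤ₄ → ℕ) → sum (tabulate a) ≡ S → a 0F + a 2F ≡ a 1F + a 3F →
  ∀ t → 2 * (a t + a (t ⊕ 2F)) ≡ S
halves {S} a total e = go
  where
  double : ∀ a₀ a₁ a₂ a₃ S →
    2 * (a₀ + a₂) + ((a₁ + a₃) + S) ≡ S + ((a₀ + a₂) + (a₀ + (a₁ + (a₂ + (a₃ + 0)))))
  double = solve-∀

  even : 2 * (a 0F + a 2F) ≡ S
  even = by-linear-combination (e ⊞ total) (double (a 0F) (a 1F) (a 2F) (a 3F) S)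

  odd : 2 * (a 1F + a 3F) ≡ S
  odd = trans (cong (2 *_) (sym e)) even

  go : ∀ t → 2 * (a t + a (t ⊕ 2F)) ≡ S
  go 0F = even
  go 1F = odd
  go 2F = trans (cong (2 *_) (+-comm (a 2F) (a 0F))) even
  go 3F = trans (cong (2 *_) (+-comm (a 3F) (a 1F))) odd

theorem12 : (m : ℕ) → 1 ≤ m →
    (2 ∤ m → (S : ℕ) (h : Hypercube m) → Magic S h → Compact S h → Pandiagonal S h)
    × (2 ∣ m → (S : ℕ) (h : Hypercube m) → Magic S h → Compact S h → Pandiagonal S h → MostPerfect S h)
theorem12 m _ =
  (λ 2∤m S h magic compact → pandiagonal-odd (entry h) 2∤m magic compact) ,
  (λ 2∣m S h magic compact pandiagonal → record
    { magic       = magic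
    ; compact     = compact
    ; pandiagonal = pandiagonal
    ; complete    = λ p d → halves (λ t → entry h (along p d t)) (pandiagonal p d)
        (pandiagonal-even (entry h) 2∣m magic compact p d)
    })
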